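{- Let $n,m$ be positive integers with $m>1$. (a) $\nu(n)=\nu(n,m)=\lceil n/2\rceil$. (b) If $n\ge m$, then $\nu^*(n,m)=\nu(n,m)+1$ if $n$ is even and $m$ is odd, and $\nu^*(n,m)=\nu(n,m)$ otherwise. In particular, $\nu^*(n,2)=\nu^*(n)=\nu(n)$ for all $n>1$.
   Context: Let $\mathbb F_2=\{0,1\}$ be the field with two elements. For $u\in\mathbb F_2^n$, $|u|$ denotes the Hamming weight of $u$. A wiring on $n$ vertices is a matrix $W=(w_{i,j})\in M(n,n;\mathbb F_2)$ with $w_{i,i}=1$ for all $i$. The degree of vertex $j$ is the number of $1$s in the $j$th column of $W$, and $\deg(W)$ is the maximum degree over all vertices. For $c\in\mathbb F_2^n$, $M(W,c)=\max\{|Wx+c| : x\in\mathbb F_2^n\}$. For $n,m\ge1$, $A(n,m)$ is the set of wirings on $n$ vertices with $\deg(W)\le m$; for $n\ge m$, $A^*(n,m)$ is the set of wirings on $n$ vertices in which every vertex has degree exactly $m$. Define $\nu(n,m)=\min\{M(W,c): W\in A(n,m),\ c\in\mathbb F_2^n\}$, for $n\ge m$ $\nu^*(n,m)=\min\{M(W,c): W\in A^*(n,m),\ c\in\mathbb F_2^n\}$, and $\nu(n)=\nu(n,n)$, $\nu^*(n)=\nu^*(n,n)$. -}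

module Defs where

open import Data.Nat.Base using (ℕ; zero; suc; _≤_; z≤n)
import Data.Nat.Properties as ℕ
open import Data.Fin.Base using (Fin)
import Data.Fin.Properties as Fin
open import Data.Parity.Base as ℙ using (Parity; 0ℙ; 1ℙ)
import Data.Parity.Properties as ℙ
open import Data.Vec.Base as Vec using (Vec; []; _∷_; lookup; tabulate; zipWith; count)
open import Data.Vec.Properties using (count≤n)
open import Data.List.Base using (List; []; _∷_; map; filter; allFin; cartesianProductWith)
open import Data.List.Extrema.Nat using (max; min; argmax-sel; argmin-sel; xs≤max; min≤xs)
open import Data.List.Membership.Propositional using (_∈_)
open import Data.List.Membership.Propositional.Properties using (∈-cartesianProductWith⁺; ∈-cartesianProductWith⁻; ∈-map⁺; ∈-map⁻; ∈-filter⁺; ∈-filter⁻; ∈-allFin)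
open import Data.List.Relation.Unary.Any using (here; there)
import Data.List.Relation.Unary.All as All
open import Data.Product.Base using (_×_; _,_; ∃-syntax; proj₂)
open import Data.Sum.Base using (inj₁; inj₂)
open import Function.Base using (id)
open import Relation.Nullary.Decidable using (_×-dec_)
open import Relation.Unary using (Pred; Decidable)
open import Relation.Binary.PropositionalEquality using (_≡_; refl; sym; trans; subst)
open import Level using (0ℓ)
open import Algebra.Properties.CommutativeMonoid.Sum ℙ.+-0-commutativeMonoid using (sum)

-- Parity with its ring structure ℙ.+-*-commutativeRing is the field with
-- two elements.
𝔽₂ : Set
𝔽₂ = Parity

𝔽₂^ : ℕ → Set
𝔽₂^ n = Vec 𝔽₂ n

-- Square matrices, stored as vectors of rows.
Mat : ℕ → Set
Mat n = Vec (𝔽₂^ n) n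

private
  variable
    n : ℕ

infix 9 _⟨_,_⟩

_⟨_,_⟩ : Mat n → Fin n → Fin n → 𝔽₂
W ⟨ i , j ⟩ = lookup (lookup W i) j

infixl 7 _·_
infixl 6 _⊕_

_·_ : Mat n → 𝔽₂^ n → 𝔽₂^ n
W · x = tabulate λ i → sum λ j → W ⟨ i , j ⟩ ℙ.* lookup x j

_⊕_ : 𝔽₂^ n → 𝔽₂^ n → 𝔽₂^ n
_⊕_ = zipWith ℙ._+_

∣_∣ : 𝔽₂^ n → ℕ
∣ u ∣ = count (ℙ._≟ 1ℙ) u

column : Mat n → Fin n → 𝔽₂^ n
column W j = tabulate λ i → W ⟨ i , j ⟩

IsWiring : Pred (Mat n) 0ℓ
IsWiring W = ∀ i → W ⟨ i , i ⟩ ≡ 1ℙ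

degree : Mat n → Fin n → ℕ
degree W j = ∣ column W j ∣

deg : Mat n → ℕ
deg W = max 0 (map (degree W) (allFin _))

A : ∀ n m → Pred (Mat n) 0ℓ
A n m W = IsWiring W × deg W ≤ m

A* : ∀ n m → Pred (Mat n) 0ℓ
A* n m W = IsWiring W × (∀ j → degree W j ≡ m)

isWiring? : Decidable (IsWiring {n})
isWiring? W = Fin.all? λ i → W ⟨ i , i ⟩ ℙ.≟ 1ℙ

A? : ∀ n m → Decidable (A n m)
A? n m W = isWiring? W ×-dec (deg W ℕ.≤? m)

A*? : ∀ n m → Decidable (A* n m)
A*? n m W = isWiring? W ×-dec Fin.all? λ j → degree W j ℕ.≟ m

-- All vectors of length n with entries from the given list.
vectorsOver : {X : Set} → List X → ∀ n → List (Vec X n)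
vectorsOver xs zero    = [] ∷ []
vectorsOver xs (suc n) = cartesianProductWith _∷_ xs (vectorsOver xs n)

all𝔽₂^ : ∀ n → List (𝔽₂^ n)
all𝔽₂^ = vectorsOver (0ℙ ∷ 1ℙ ∷ [])

allMat : ∀ n → List (Mat n)
allMat n = vectorsOver (all𝔽₂^ n) n

M : Mat n → 𝔽₂^ n → ℕ
M {n} W c = max 0 (map (λ x → ∣ W · x ⊕ c ∣) (all𝔽₂^ n))

-- The minimum of M W c over c and over those W that satisfy a decidable
-- predicate.  Since M W c ≤ n, the initial value n does not influence the
-- result unless no W satisfies the predicate (see minM-attained).
minM : ∀ n {P : Pred (Mat n) 0ℓ} → Decidable P → ℕ
minM n P? = min n (cartesianProductWith M (filter P? (allMat n)) (all𝔽₂^ n))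

ν : ℕ → ℕ → ℕ
ν n m = minM n (A? n m)

-- Meaningful only for 1 ≤ m ≤ n; otherwise A* n m may be empty.
ν* : ℕ → ℕ → ℕ
ν* n m = minM n (A*? n m)

-- The one-argument ν(n) and ν*(n).
ν₁ : ℕ → ℕ
ν₁ n = ν n n

ν₁* : ℕ → ℕ
ν₁* n = ν* n n

-- The list-based extrema above are the maxima and minima of the
-- corresponding sets.

∈-vectorsOver : {X : Set} {xs : List X} → (∀ x → x ∈ xs) → (v : Vec X n) → v ∈ vectorsOver xs n
∈-vectorsOver all []      = here refl
∈-vectorsOver all (x ∷ v) = ∈-cartesianProductWith⁺ _∷_ (all x) (∈-vectorsOver all v)

∈-all𝔽₂^ : (v : 𝔽₂^ n) → v ∈ all𝔽₂^ n
∈-all𝔽₂^ = ∈-vectorsOver λ { 0ℙ → here refl ; 1ℙ → there (here refl) }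

∈-allMat : (W : Mat n) → W ∈ allMat n
∈-allMat = ∈-vectorsOver ∈-all𝔽₂^

max-attained : ∀ {y} xs → y ∈ xs → max 0 xs ∈ xs
max-attained {y} xs y∈xs with argmax-sel id 0 xs
... | inj₂ p  = p
... | inj₁ eq = subst (_∈ xs) (trans y≡0 (sym eq)) y∈xs
  where
  y≡0 : y ≡ 0
  y≡0 = ℕ.n≤0⇒n≡0 (subst (y ≤_) eq (All.lookup (xs≤max 0 xs) y∈xs))

degree≤deg : (W : Mat n) (j : Fin n) → degree W j ≤ deg W
degree≤deg W j = All.lookup (xs≤max 0 _) (∈-map⁺ (degree W) (∈-allFin j))

deg-attained : (W : Mat (suc n)) → ∃[ j ] deg W ≡ degree W j
deg-attained W with ∈-map⁻ (degree W) (max-attained (map (degree W) (allFin _)) (here refl))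
... | j , _ , eq = j , eq

∣Wx+c∣≤M : (W : Mat n) (c x : 𝔽₂^ n) → ∣ W · x ⊕ c ∣ ≤ M W c
∣Wx+c∣≤M W c x = All.lookup (xs≤max 0 _) (∈-map⁺ (λ x → ∣ W · x ⊕ c ∣) (∈-all𝔽₂^ x))

M-attained : (W : Mat n) (c : 𝔽₂^ n) → ∃[ x ] M W c ≡ ∣ W · x ⊕ c ∣
M-attained {n} W c with ∈-map⁻ f (max-attained (map f (all𝔽₂^ n)) (∈-map⁺ f (∈-all𝔽₂^ c)))
  where
  f : 𝔽₂^ n → ℕ
  f x = ∣ W · x ⊕ c ∣
... | x , _ , eq = x , eq

M≤n : (W : Mat n) (c : 𝔽₂^ n) → M W c ≤ n
M≤n W c with M-attained W c
... | x , eq = subst (_≤ _) (sym eq) (count≤n (ℙ._≟ 1ℙ) (W · x ⊕ c))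

module _ {P : Pred (Mat n) 0ℓ} (P? : Decidable P) where

  private
    values : List ℕ
    values = cartesianProductWith M (filter P? (allMat n)) (all𝔽₂^ n)

    M∈values : ∀ {W} → P W → ∀ c → M W c ∈ values
    M∈values PW c = ∈-cartesianProductWith⁺ M (∈-filter⁺ P? (∈-allMat _) PW) (∈-all𝔽₂^ c)

    values⁻ : ∀ {k} → k ∈ values → ∃[ W ] ∃[ c ] P W × k ≡ M W c
    values⁻ k∈ with ∈-cartesianProductWith⁻ M (filter P? (allMat n)) (all𝔽₂^ n) k∈
    ... | W , c , W∈ , _ , eq = W , c , proj₂ (∈-filter⁻ P? {xs = allMat n} W∈) , eq

  minM≤M : ∀ {W} → P W → ∀ c → minM n P? ≤ M W c
  minM≤M PW c = All.lookup (min≤xs n values) (M∈values PW c)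

  minM-attained : ∃[ W ] P W → ∃[ W ] ∃[ c ] P W × minM n P? ≡ M W c
  minM-attained (W , PW) with argmin-sel id n values
  ... | inj₂ p  = values⁻ p
  ... | inj₁ eq = W , c , PW , ℕ.≤-antisym (minM≤M PW c) (subst (M W c ≤_) (sym eq) (M≤n W c))
    where
    c : 𝔽₂^ n
    c = Vec.replicate n 0ℙ

{-# OPTIONS --safe #-}

-- Lower bound.  The rows of a wiring are nonzero, so ∣ W x + c ∣ has average n/2
-- over all x; hence either some value exceeds n/2 or all values equal n/2.  If
-- all columns have odd weight, then switching one coordinate of x changes the
-- parity of ∣ W x + c ∣, which excludes the second alternative.
--
-- Upper bound.  If all columns of W lie in a subspace of 𝔽₂ⁿ, then so does every
-- W x.  When two coordinates agree on this subspace and c is 0 at one of them and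
-- 1 at the other, the two contribute exactly 1 to ∣ W x + c ∣.  So we look for
-- columns that are constant on the pairs of a fixed matching of all coordinates,
-- or of all but one or two of them.  This works except when n is odd and m is even:
-- there one uses the subspace of vectors a ∷ (a + b) ∷ b ∷ v with v paired, and
-- c = 1 ∷ 0 ∷ 1 ∷ …, so that the first coordinate is lit only when the broken
-- pair contributes exactly 1.
module Submission where

open import Defs using (ν; ν*; ν₁; ν₁*; 𝔽₂; 𝔽₂^; Mat; _⟨_,_⟩; _·_; _⊕_; column; IsWiring; degree; deg; A; A*; A?; A*?; M; deg-attained; M-attained; ∣Wx+c∣≤M; M≤n; minM≤M; minM-attained) renaming (∣_∣ to ∥_∥)
open import Data.Nat.Base using (ℕ; _+_; _≤_; _<_; ⌈_/2⌉; zero; suc; z≤n; s≤s; s≤s⁻¹; ⌊_/2⌋; parity)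
import Data.Nat.Properties as ℕ
open import Data.Nat.Divisibility using (_∣_; divides; ∣m∣n⇒∣m+n; ∣-refl; _∣0)
open import Data.Fin.Base using (Fin; zero; suc)
open import Data.Parity.Base as ℙ using (0ℙ; 1ℙ)
import Data.Parity.Properties as ℙ
open import Data.Vec.Base using ([]; _∷_; lookup; tabulate; replicate; tail)
open import Data.Vec.Properties using (lookup∘tabulate; tabulate∘lookup; tabulate-cong; lookup-zipWith; lookup-replicate; zipWith-identityˡ)
open import Data.Vec.Functional as Vector using (Vector)
open import Data.Product.Base using (_×_; _,_; ∃-syntax; proj₁; proj₂)
open import Data.Sum.Base using (_⊎_; inj₁; inj₂)
open import Function.Base using (_∘_)
open import Relation.Nullary.Negation using (¬_; contradiction)
open import Relation.Unary using (Pred)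
open import Relation.Binary.Definitions using (tri<; tri≈; tri>)
open import Relation.Binary.PropositionalEquality using (_≡_; refl; sym; trans; cong; cong₂; subst; module ≡-Reasoning)
open import Level using (0ℓ)
open import Algebra.Properties.CommutativeMonoid.Sum ℙ.+-0-commutativeMonoid using (sum; sum-cong-≗; sum-replicate-zero)
import Algebra.Properties.CommutativeMonoid.Sum ℕ.+-0-commutativeMonoid as ∑ℕ

private
  variable
    k m n : ℕ

-- Averages of affine functions

bit : 𝔽₂ → ℕ
bit 0ℙ = 0
bit 1ℙ = 1

∥∷∥ : ∀ a (v : 𝔽₂^ n) → ∥ a ∷ v ∥ ≡ bit a + ∥ v ∥
∥∷∥ 0ℙ v = refl
∥∷∥ 1ℙ v = refl

∥∥≡sum : (v : 𝔽₂^ n) → ∥ v ∥ ≡ ∑ℕ.sum (bit ∘ lookup v)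
∥∥≡sum []      = refl
∥∥≡sum (a ∷ v) = trans (∥∷∥ a v) (cong (bit a +_) (∥∥≡sum v))

-- Twice the average of bit (ρ x + c) over all x.
mean₂ : Vector 𝔽₂ k → 𝔽₂ → ℕ
mean₂ {zero}  ρ c = bit c + bit c
mean₂ {suc k} ρ c with ρ zero
... | 0ℙ = mean₂ (Vector.tail ρ) c
... | 1ℙ = 1

-- Adding 1 to the constant swaps the bits 0 and 1 at every x, so the two averages add up to 1.
mean₂-complement : (ρ : Vector 𝔽₂ k) (c : 𝔽₂) → mean₂ ρ c + mean₂ ρ (1ℙ ℙ.+ c) ≡ 2
mean₂-complement {zero}  ρ 0ℙ = refl
mean₂-complement {zero}  ρ 1ℙ = refl
mean₂-complement {suc k} ρ c with ρ zero
... | 0ℙ = mean₂-complement (Vector.tail ρ) c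
... | 1ℙ = refl

-- Condition on the first coordinate: setting it to 1 moves `ρ zero` into the constant, and the
-- average over all x is the mean of the averages over the two halves.
mean₂-split : (ρ : Vector 𝔽₂ (suc k)) (c : 𝔽₂) →
  mean₂ (Vector.tail ρ) c + mean₂ (Vector.tail ρ) (ρ zero ℙ.+ c) ≡ mean₂ ρ c + mean₂ ρ c
mean₂-split ρ c with ρ zero
... | 0ℙ = refl
... | 1ℙ = mean₂-complement (Vector.tail ρ) c

-- A nonzero linear form takes both values equally often, so the average is 1/2 whatever the
-- constant.
mean₂-nonzero : (ρ : Vector 𝔽₂ k) (c : 𝔽₂) (j : Fin k) → ρ j ≡ 1ℙ → mean₂ ρ c ≡ 1
mean₂-nonzero ρ c zero    eq rewrite eq = refl
mean₂-nonzero ρ c (suc j) eq with ρ zero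
... | 0ℙ = mean₂-nonzero (Vector.tail ρ) c j eq
... | 1ℙ = refl

module _ {r : ℕ} where

  -- The number `r` of affine functions is kept apart from the number `k` of variables, so that an
  -- induction can eliminate variables while all functions remain.
  value : (Fin r → Vector 𝔽₂ k) → Vector 𝔽₂ r → 𝔽₂^ k → ℕ
  value a c x = ∑ℕ.sum λ i → bit (sum (λ j → a i j ℙ.* lookup x j) ℙ.+ c i)

  mean : (Fin r → Vector 𝔽₂ k) → Vector 𝔽₂ r → ℕ
  mean a c = ∑ℕ.sum λ i → mean₂ (a i) (c i)

  restrict : (Fin r → Vector 𝔽₂ (suc k)) → Fin r → Vector 𝔽₂ k
  restrict a i = Vector.tail (a i)

  shift : (Fin r → Vector 𝔽₂ (suc k)) → Vector 𝔽₂ r → Vector 𝔽₂ r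
  shift a c i = a i zero ℙ.+ c i

  value-0∷ : (a : Fin r → Vector 𝔽₂ (suc k)) (c : Vector 𝔽₂ r) (x : 𝔽₂^ k) →
    value a c (0ℙ ∷ x) ≡ value (restrict a) c x
  value-0∷ a c x = ∑ℕ.sum-cong-≗ λ i →
    cong (λ z → bit ((z ℙ.+ sum (λ j → a i (suc j) ℙ.* lookup x j)) ℙ.+ c i)) (ℙ.*-zeroʳ (a i zero))

  value-1∷ : (a : Fin r → Vector 𝔽₂ (suc k)) (c : Vector 𝔽₂ r) (x : 𝔽₂^ k) →
    value a c (1ℙ ∷ x) ≡ value (restrict a) (shift a c) x
  value-1∷ a c x = ∑ℕ.sum-cong-≗ λ i → cong bit (eq (a i zero) (sum λ j → a i (suc j) ℙ.* lookup x j) (c i))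
    where
    open ≡-Reasoning
    eq : ∀ p s q → ((p ℙ.* 1ℙ) ℙ.+ s) ℙ.+ q ≡ s ℙ.+ (p ℙ.+ q)
    eq p s q = begin
      ((p ℙ.* 1ℙ) ℙ.+ s) ℙ.+ q ≡⟨ cong (λ z → (z ℙ.+ s) ℙ.+ q) (ℙ.*-identityʳ p) ⟩
      (p ℙ.+ s) ℙ.+ q          ≡⟨ cong (ℙ._+ q) (ℙ.+-comm p s) ⟩
      (s ℙ.+ p) ℙ.+ q          ≡⟨ ℙ.+-assoc s p q ⟩
      s ℙ.+ (p ℙ.+ q)          ∎

  mean-split : (a : Fin r → Vector 𝔽₂ (suc k)) (c : Vector 𝔽₂ r) →
    mean (restrict a) c + mean (restrict a) (shift a c) ≡ mean a c + mean a c
  mean-split a c = begin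
    mean (restrict a) c + mean (restrict a) (shift a c)
      ≡⟨ ∑ℕ.∑-distrib-+ (λ i → mean₂ (restrict a i) (c i)) _ ⟨
    ∑ℕ.sum (λ i → mean₂ (restrict a i) (c i) + mean₂ (restrict a i) (shift a c i))
      ≡⟨ ∑ℕ.sum-cong-≗ (λ i → mean₂-split (a i) (c i)) ⟩
    ∑ℕ.sum (λ i → mean₂ (a i) (c i) + mean₂ (a i) (c i))
      ≡⟨ ∑ℕ.∑-distrib-+ (λ i → mean₂ (a i) (c i)) _ ⟩
    mean a c + mean a c ∎
    where open ≡-Reasoning

  AboveMean : (Fin r → Vector 𝔽₂ k) → Vector 𝔽₂ r → ℕ → Set
  AboveMean a c μ = ∃[ x ] μ < value a c x + value a c x

  ConstantlyMean : (Fin r → Vector 𝔽₂ k) → Vector 𝔽₂ r → ℕ → Set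
  ConstantlyMean a c μ = ∀ x → value a c x + value a c x ≡ μ

  aboveMean-<  : (a : Fin r → Vector 𝔽₂ k) (c : Vector 𝔽₂ r) {μ μ′ : ℕ} → μ < μ′ →
    AboveMean a c μ′ ⊎ ConstantlyMean a c μ′ → AboveMean a c μ
  aboveMean-< a c μ<μ′ (inj₁ (x , μ′<)) = x , ℕ.<-trans μ<μ′ μ′<
  aboveMean-< a c μ<μ′ (inj₂ const)     = x , subst (_ <_) (sym (const x)) μ<μ′
    where x = replicate _ 0ℙ

  aboveMean-0∷ : (a : Fin r → Vector 𝔽₂ (suc k)) (c : Vector 𝔽₂ r) {μ : ℕ} →
    AboveMean (restrict a) c μ → AboveMean a c μ
  aboveMean-0∷ a c (x , μ<) = 0ℙ ∷ x , subst (λ v → _ < v + v) (sym (value-0∷ a c x)) μ<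

  aboveMean-1∷ : (a : Fin r → Vector 𝔽₂ (suc k)) (c : Vector 𝔽₂ r) {μ : ℕ} →
    AboveMean (restrict a) (shift a c) μ → AboveMean a c μ
  aboveMean-1∷ a c (x , μ<) = 1ℙ ∷ x , subst (λ v → _ < v + v) (sym (value-1∷ a c x)) μ<

  -- Induction on the number of variables. The mean is the average of the means over the halves with
  -- first coordinate 0 and 1. If one half has a larger mean, either alternative there yields a
  -- value above the overall mean. If the halves have equal means, an excess in either one lifts,
  -- and otherwise both are constant with the same value. Values are doubled to stay in ℕ.
  aboveMean⊎constant : (a : Fin r → Vector 𝔽₂ k) (c : Vector 𝔽₂ r) →
    AboveMean a c (mean a c) ⊎ ConstantlyMean a c (mean a c)
  aboveMean⊎constant {k = zero}  a c = inj₂ λ { [] → sym (∑ℕ.∑-distrib-+ (bit ∘ c) (bit ∘ c)) }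
  aboveMean⊎constant {k = suc k} a c
    with ℕ.<-cmp (mean a c) (mean (restrict a) c)
  ... | tri< μ<μ₀ _ _ = inj₁ (aboveMean-0∷ a c (aboveMean-< (restrict a) c μ<μ₀ (aboveMean⊎constant (restrict a) c)))
  ... | tri> _ _ μ₀<μ = inj₁ (aboveMean-1∷ a c (aboveMean-< (restrict a) (shift a c) μ<μ₁ (aboveMean⊎constant (restrict a) (shift a c))))
    where
    μ<μ₁ : mean a c < mean (restrict a) (shift a c)
    μ<μ₁ = ℕ.≰⇒> λ μ₁≤μ → ℕ.<⇒≢ (ℕ.+-mono-<-≤ μ₀<μ μ₁≤μ) (mean-split a c)
  ... | tri≈ _ μ≡μ₀ _ = combine (aboveMean⊎constant (restrict a) c) (aboveMean⊎constant (restrict a) (shift a c))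
    where
    μ₁≡μ : mean (restrict a) (shift a c) ≡ mean a c
    μ₁≡μ = ℕ.+-cancelˡ-≡ (mean a c) _ _ (trans (cong (_+ mean (restrict a) (shift a c)) μ≡μ₀) (mean-split a c))

    combine : AboveMean (restrict a) c (mean (restrict a) c) ⊎ ConstantlyMean (restrict a) c (mean (restrict a) c) →
      AboveMean (restrict a) (shift a c) (mean (restrict a) (shift a c)) ⊎ ConstantlyMean (restrict a) (shift a c) (mean (restrict a) (shift a c)) →
      AboveMean a c (mean a c) ⊎ ConstantlyMean a c (mean a c)
    combine (inj₁ above) _            = inj₁ (subst (AboveMean a c) (sym μ≡μ₀) (aboveMean-0∷ a c above))
    combine (inj₂ _)     (inj₁ above) = inj₁ (subst (AboveMean a c) μ₁≡μ (aboveMean-1∷ a c above))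
    combine (inj₂ const₀) (inj₂ const₁) = inj₂ λ where
      (0ℙ ∷ x) → trans (cong (λ v → v + v) (value-0∷ a c x)) (trans (const₀ x) (sym μ≡μ₀))
      (1ℙ ∷ x) → trans (cong (λ v → v + v) (value-1∷ a c x)) (trans (const₁ x) μ₁≡μ)

-- Lower bounds for M

∥Wx+c∥≡value : (W : Mat n) (c x : 𝔽₂^ n) → ∥ W · x ⊕ c ∥ ≡ value (W ⟨_,_⟩) (lookup c) x
∥Wx+c∥≡value W c x = trans (∥∥≡sum (W · x ⊕ c)) (∑ℕ.sum-cong-≗ λ i → cong bit
  (trans (lookup-zipWith ℙ._+_ i (W · x) c) (cong (ℙ._+ lookup c i) (lookup∘tabulate _ i))))

sum-1 : ∀ n → ∑ℕ.sum {n} (λ _ → 1) ≡ n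
sum-1 zero    = refl
sum-1 (suc n) = cong suc (sum-1 n)

wiring-mean : (W : Mat n) (c : 𝔽₂^ n) → IsWiring W → mean (W ⟨_,_⟩) (lookup c) ≡ n
wiring-mean {n} W c wiring =
  trans (∑ℕ.sum-cong-≗ λ i → mean₂-nonzero (W ⟨ i ,_⟩) (lookup c i) i (wiring i)) (sum-1 n)

wiring-values : (W : Mat n) (c : 𝔽₂^ n) → IsWiring W →
  (∃[ x ] n < ∥ W · x ⊕ c ∥ + ∥ W · x ⊕ c ∥) ⊎ (∀ x → ∥ W · x ⊕ c ∥ + ∥ W · x ⊕ c ∥ ≡ n)
wiring-values W c wiring with aboveMean⊎constant (W ⟨_,_⟩) (lookup c)
... | inj₁ (x , μ<) rewrite wiring-mean W c wiring =
  inj₁ (x , subst (λ v → _ < v + v) (sym (∥Wx+c∥≡value W c x)) μ<)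
... | inj₂ const    rewrite wiring-mean W c wiring =
  inj₂ λ x → trans (cong (λ v → v + v) (∥Wx+c∥≡value W c x)) (const x)

n≤k+k⇒⌈n/2⌉≤k : n ≤ k + k → ⌈ n /2⌉ ≤ k
n≤k+k⇒⌈n/2⌉≤k {n} {k} n≤ = subst (⌈ n /2⌉ ≤_) (sym (ℕ.n≡⌈n+n/2⌉ k)) (ℕ.⌈n/2⌉-mono n≤)

⌈n/2⌉≤M : (W : Mat n) (c : 𝔽₂^ n) → IsWiring W → ⌈ n /2⌉ ≤ M W c
⌈n/2⌉≤M W c wiring with wiring-values W c wiring
... | inj₁ (x , n<) = ℕ.≤-trans (n≤k+k⇒⌈n/2⌉≤k (ℕ.<⇒≤ n<)) (∣Wx+c∣≤M W c x)
... | inj₂ const    = ℕ.≤-trans (n≤k+k⇒⌈n/2⌉≤k (ℕ.≤-reflexive (sym (const c)))) (∣Wx+c∣≤M W c c)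

-- Parity of Hamming weights.

parity-bit : ∀ a → parity (bit a) ≡ a
parity-bit 0ℙ = refl
parity-bit 1ℙ = refl

parity-∷ : ∀ a (v : 𝔽₂^ n) → parity ∥ a ∷ v ∥ ≡ a ℙ.+ parity ∥ v ∥
parity-∷ a v = begin
  parity ∥ a ∷ v ∥                ≡⟨ cong parity (∥∷∥ a v) ⟩
  parity (bit a + ∥ v ∥)          ≡⟨ ℙ.+-homo-+ (bit a) ∥ v ∥ ⟩
  parity (bit a) ℙ.+ parity ∥ v ∥ ≡⟨ cong (ℙ._+ parity ∥ v ∥) (parity-bit a) ⟩
  a ℙ.+ parity ∥ v ∥              ∎
  where open ≡-Reasoning

+-interchange : ∀ a b c d → (a ℙ.+ b) ℙ.+ (c ℙ.+ d) ≡ (a ℙ.+ c) ℙ.+ (b ℙ.+ d)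
+-interchange = interchange
  where open import Algebra.Properties.CommutativeSemigroup ℙ.+-commutativeSemigroup using (interchange)

-- Coordinates at which both vectors are 1 cancel two at a time; the parity of the weight is the
-- linear form that sums all coordinates.
parity-⊕ : (u v : 𝔽₂^ n) → parity ∥ u ⊕ v ∥ ≡ parity ∥ u ∥ ℙ.+ parity ∥ v ∥
parity-⊕ []      []      = refl
parity-⊕ (a ∷ u) (b ∷ v) = begin
  parity ∥ (a ℙ.+ b) ∷ (u ⊕ v) ∥                       ≡⟨ parity-∷ (a ℙ.+ b) (u ⊕ v) ⟩
  (a ℙ.+ b) ℙ.+ parity ∥ u ⊕ v ∥                       ≡⟨ cong ((a ℙ.+ b) ℙ.+_) (parity-⊕ u v) ⟩
  (a ℙ.+ b) ℙ.+ (parity ∥ u ∥ ℙ.+ parity ∥ v ∥)        ≡⟨ +-interchange a b _ _ ⟩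
  (a ℙ.+ parity ∥ u ∥) ℙ.+ (b ℙ.+ parity ∥ v ∥)        ≡⟨ cong₂ ℙ._+_ (parity-∷ a u) (parity-∷ b v) ⟨
  parity ∥ a ∷ u ∥ ℙ.+ parity ∥ b ∷ v ∥                ∎
  where open ≡-Reasoning

tabulate≡ : {f : Fin n → 𝔽₂} (v : 𝔽₂^ n) → (∀ i → f i ≡ lookup v i) → tabulate f ≡ v
tabulate≡ v f≗v = trans (tabulate-cong f≗v) (tabulate∘lookup v)

sum-*-0 : (w : Vector 𝔽₂ n) → sum (λ j → w j ℙ.* lookup (replicate n 0ℙ) j) ≡ 0ℙ
sum-*-0 {n} w = trans
  (sum-cong-≗ λ j → trans (cong (w j ℙ.*_) (lookup-replicate j 0ℙ)) (ℙ.*-zeroʳ (w j)))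
  (sum-replicate-zero n)

·-zero : (W : Mat n) → W · replicate n 0ℙ ≡ replicate n 0ℙ
·-zero W = tabulate≡ _ λ i → trans (sum-*-0 (W ⟨ i ,_⟩)) (sym (lookup-replicate i 0ℙ))

·-e₀ : (W : Mat (suc n)) → W · (1ℙ ∷ replicate n 0ℙ) ≡ column W zero
·-e₀ W = tabulate-cong λ i → trans
  (cong₂ ℙ._+_ (ℙ.*-identityʳ (W ⟨ i , zero ⟩)) (sum-*-0 λ j → W ⟨ i , suc j ⟩))
  (ℙ.+-identityʳ (W ⟨ i , zero ⟩))

m+m≡n+n⇒m≡n : m + m ≡ n + n → m ≡ n
m+m≡n+n⇒m≡n {m} {n} eq = trans (ℕ.n≡⌊n+n/2⌋ m) (trans (cong ⌊_/2⌋ eq) (sym (ℕ.n≡⌊n+n/2⌋ n)))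

+-cancelʳ-0 : ∀ p q → p ℙ.+ q ≡ q → p ≡ 0ℙ
+-cancelʳ-0 0ℙ q  _ = refl
+-cancelʳ-0 1ℙ 0ℙ ()
+-cancelʳ-0 1ℙ 1ℙ ()

⌊n/2⌋<M : (W : Mat n) (c : 𝔽₂^ n) → 1 ≤ n → IsWiring W → (∀ j → parity (degree W j) ≡ 1ℙ) →
  ⌊ n /2⌋ < M W c
⌊n/2⌋<M {suc n} W c _ wiring odd with wiring-values W c wiring
-- With N = `suc n` vertices, `n<` says that N + 1 is at most twice the weight, and ⌈(N + 1)/2⌉
-- reduces to 1 + ⌊N/2⌋.
... | inj₁ (x , n<) = ℕ.≤-trans (n≤k+k⇒⌈n/2⌉≤k n<) (∣Wx+c∣≤M W c x)
... | inj₂ const    = contradiction (trans (sym (odd zero)) even) λ ()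
  where
  open ≡-Reasoning
  0ⁿ e₀ : 𝔽₂^ (suc n)
  0ⁿ = replicate (suc n) 0ℙ
  e₀ = 1ℙ ∷ replicate n 0ℙ

  -- Compare x = `e₀` with x = 0: equal weights of column 0 plus `c` and of `c` itself force column
  -- 0 to have even weight.
  even : parity (degree W zero) ≡ 0ℙ
  even = +-cancelʳ-0 _ (parity ∥ c ∥) (begin
    parity ∥ column W zero ∥ ℙ.+ parity ∥ c ∥ ≡⟨ parity-⊕ (column W zero) c ⟨
    parity ∥ column W zero ⊕ c ∥              ≡⟨ cong (λ v → parity ∥ v ⊕ c ∥) (·-e₀ W) ⟨
    parity ∥ W · e₀ ⊕ c ∥                     ≡⟨ cong parity {∥ W · e₀ ⊕ c ∥} {∥ W · 0ⁿ ⊕ c ∥} (m+m≡n+n⇒m≡n {∥ W · e₀ ⊕ c ∥} {∥ W · 0ⁿ ⊕ c ∥} (trans (const e₀) (sym (const 0ⁿ)))) ⟩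
    parity ∥ W · 0ⁿ ⊕ c ∥                     ≡⟨ cong (λ v → parity ∥ v ⊕ c ∥) (·-zero W) ⟩
    parity ∥ 0ⁿ ⊕ c ∥                         ≡⟨ cong (λ v → parity ∥ v ∥) (zipWith-identityˡ {f = ℙ._+_} ℙ.+-identityˡ c) ⟩
    parity ∥ c ∥                              ∎)

-- Wirings with columns in a given subspace

-- The scalars 0 and 1 send v to 0 and to v, so these two fields make `P` a linear subspace.
record IsSubspace (P : Pred (𝔽₂^ n) 0ℓ) : Set where
  field
    0∈ : P (replicate n 0ℙ)
    ⊕∈ : ∀ {u v} → P u → P v → P (u ⊕ v)

module _ {P : Pred (𝔽₂^ n) 0ℓ} (subspace : IsSubspace P) where
  open IsSubspace subspace

  -- The number `k` of columns is independent of their length `n`, so the induction can drop columns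
  -- and stay in the same subspace.
  combination∈ : (f : Fin k → Vector 𝔽₂ n) (x : 𝔽₂^ k) → (∀ j → P (tabulate (f j))) →
    P (tabulate λ i → sum λ j → f j i ℙ.* lookup x j)
  combination∈ f []       f∈ = subst P (sym (tabulate≡ _ λ i → sym (lookup-replicate i 0ℙ))) 0∈
  combination∈ f (0ℙ ∷ x) f∈ =
    subst P (tabulate-cong λ i → sym (cong (ℙ._+ sum (λ j → f (suc j) i ℙ.* lookup x j)) (ℙ.*-zeroʳ (f zero i))))
      (combination∈ (f ∘ suc) x (f∈ ∘ suc))
  combination∈ f (1ℙ ∷ x) f∈ =
    subst P (sym (tabulate≡ _ λ i → trans
        (cong₂ ℙ._+_ (trans (ℙ.*-identityʳ (f zero i)) (sym (lookup∘tabulate (f zero) i))) (sym (lookup∘tabulate _ i)))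
        (sym (lookup-zipWith ℙ._+_ i (tabulate (f zero)) _))))
      (⊕∈ (f∈ zero) (combination∈ (f ∘ suc) x (f∈ ∘ suc)))

  ·∈ : (W : Mat n) (x : 𝔽₂^ n) → (∀ j → P (column W j)) → P (W · x)
  ·∈ W x = combination∈ (λ j i → W ⟨ i , j ⟩) x

  M≤bound : (W : Mat n) (c : 𝔽₂^ n) {b : ℕ} → (∀ j → P (column W j)) →
    (∀ v → P v → ∥ v ⊕ c ∥ ≤ b) → M W c ≤ b
  M≤bound W c W∈ bound with M-attained W c
  ... | x , eq = subst (_≤ _) (sym eq) (bound (W · x) (·∈ W x W∈))

fromColumns : (Fin n → 𝔽₂^ n) → Mat n
fromColumns f = tabulate λ i → tabulate λ j → lookup (f j) i

fromColumns-entry : (f : Fin n → 𝔽₂^ n) (i j : Fin n) → fromColumns f ⟨ i , j ⟩ ≡ lookup (f j) i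
fromColumns-entry f i j = trans
  (cong (λ row → lookup row j) (lookup∘tabulate (λ i → tabulate λ j → lookup (f j) i) i))
  (lookup∘tabulate (λ j → lookup (f j) i) j)

column-fromColumns : (f : Fin n → 𝔽₂^ n) (j : Fin n) → column (fromColumns f) j ≡ f j
column-fromColumns f j = tabulate≡ (f j) λ i → fromColumns-entry f i j

Column : Pred (𝔽₂^ n) 0ℓ → ℕ → Fin n → Set
Column P m j = ∃[ v ] P v × lookup v j ≡ 1ℙ × ∥ v ∥ ≡ m

-- Degrees are required to be exact so that one witness bounds both `ν*` and, through `deg W ≤ m`,
-- also `ν`.
WiringBound : ℕ → ℕ → ℕ → Set
WiringBound n m b = ∃[ W ] ∃[ c ] A* n m W × M W c ≤ b

wiringInSubspace : {P : Pred (𝔽₂^ n) 0ℓ} {b : ℕ} → IsSubspace P → (∀ j → Column P m j) →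
  (c : 𝔽₂^ n) → (∀ v → P v → ∥ v ⊕ c ∥ ≤ b) → WiringBound n m b
wiringInSubspace {P = P} subspace columns c bound = W , c , (wiring , degrees) ,
  M≤bound subspace W c (λ j → subst P (sym (column-fromColumns f j)) (proj₁ (proj₂ (columns j)))) bound
  where
  f = λ j → proj₁ (columns j)
  W = fromColumns f

  wiring : IsWiring W
  wiring i = trans (fromColumns-entry f i i) (proj₁ (proj₂ (proj₂ (columns i))))

  degrees : ∀ j → degree W j ≡ _
  degrees j = trans (cong ∥_∥ (column-fromColumns f j)) (proj₂ (proj₂ (proj₂ (columns j))))

-- Paired vectors

data Paired : Pred (𝔽₂^ n) 0ℓ where
  []  : Paired []
  _∷_ : ∀ a {v : 𝔽₂^ n} → Paired v → Paired (a ∷ a ∷ v)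

paired-⊕ : {u v : 𝔽₂^ n} → Paired u → Paired v → Paired (u ⊕ v)
paired-⊕ []      []      = []
paired-⊕ (a ∷ p) (b ∷ q) = (a ℙ.+ b) ∷ paired-⊕ p q

paired-0 : ∀ n → parity n ≡ 0ℙ → Paired (replicate n 0ℙ)
paired-0 zero          even = []
paired-0 (suc (suc n)) even = 0ℙ ∷ paired-0 n even

paired-subspace : parity n ≡ 0ℙ → IsSubspace (Paired {n})
paired-subspace even = record { 0∈ = paired-0 _ even ; ⊕∈ = paired-⊕ }

tail-subspace : {P : Pred (𝔽₂^ n) 0ℓ} → IsSubspace P → IsSubspace (P ∘ tail)
tail-subspace subspace = record
  { 0∈ = 0∈
  ; ⊕∈ = λ { {_ ∷ u} {_ ∷ v} u∈ v∈ → ⊕∈ u∈ v∈ }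
  }
  where open IsSubspace subspace

alternating : ∀ n → 𝔽₂^ n
alternating zero          = []
alternating (suc zero)    = 0ℙ ∷ []
alternating (suc (suc n)) = 0ℙ ∷ 1ℙ ∷ alternating n

∥paired⊕alternating∥ : {v : 𝔽₂^ n} → Paired v → ∥ v ⊕ alternating n ∥ ≡ ⌊ n /2⌋
∥paired⊕alternating∥ []       = refl
∥paired⊕alternating∥ (0ℙ ∷ p) = cong suc (∥paired⊕alternating∥ p)
∥paired⊕alternating∥ (1ℙ ∷ p) = cong suc (∥paired⊕alternating∥ p)

∥∷∥≤ : ∀ a (v : 𝔽₂^ n) {b} → ∥ v ∥ ≤ b → ∥ a ∷ v ∥ ≤ suc b
∥∷∥≤ 0ℙ v v≤b = ℕ.m≤n⇒m≤1+n v≤b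
∥∷∥≤ 1ℙ v v≤b = s≤s v≤b

pairedOfWeight : ∀ n m → parity n ≡ 0ℙ → parity m ≡ 0ℙ → m ≤ n → ∃[ v ] Paired {n} v × ∥ v ∥ ≡ m
pairedOfWeight zero          zero          _ _ _ = [] , [] , refl
pairedOfWeight (suc (suc n)) zero          n-even m-even _ with pairedOfWeight n zero n-even m-even z≤n
... | v , p , eq = 0ℙ ∷ 0ℙ ∷ v , 0ℙ ∷ p , eq
pairedOfWeight (suc (suc n)) (suc (suc m)) n-even m-even (s≤s (s≤s m≤n)) with pairedOfWeight n m n-even m-even m≤n
... | v , p , eq = 1ℙ ∷ 1ℙ ∷ v , 1ℙ ∷ p , cong (2 +_) eq

-- Two units of weight are reserved for the pair containing `j`. Pairs passed on the way to it are
-- lit while the remaining weight `m` lasts, and what is left is placed behind it.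
pairedColumn : ∀ n m → parity n ≡ 0ℙ → parity m ≡ 0ℙ → 2 + m ≤ n → (j : Fin n) → Column Paired (2 + m) j
pairedColumn (suc (suc n)) m n-even m-even (s≤s (s≤s m≤n)) zero with pairedOfWeight n m n-even m-even m≤n
... | v , p , eq = 1ℙ ∷ 1ℙ ∷ v , 1ℙ ∷ p , refl , cong (2 +_) eq
pairedColumn (suc (suc n)) m n-even m-even (s≤s (s≤s m≤n)) (suc zero) with pairedOfWeight n m n-even m-even m≤n
... | v , p , eq = 1ℙ ∷ 1ℙ ∷ v , 1ℙ ∷ p , refl , cong (2 +_) eq
-- The spare weight is used up, so this pair stays 0; matching on `n` exposes the bound 2 ≤ `n` for
-- the recursive call.
pairedColumn (suc (suc n@(suc (suc _)))) zero n-even m-even _ (suc (suc j)) with pairedColumn n zero n-even m-even (s≤s (s≤s z≤n)) j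
... | v , p , j∈ , eq = 0ℙ ∷ 0ℙ ∷ v , 0ℙ ∷ p , j∈ , eq
pairedColumn (suc (suc n)) (suc (suc m)) n-even m-even (s≤s (s≤s m≤n)) (suc (suc j)) with pairedColumn n m n-even m-even m≤n j
... | v , p , j∈ , eq = 1ℙ ∷ 1ℙ ∷ v , 1ℙ ∷ p , j∈ , cong (2 +_) eq

-- The index `d` comes with an equation, so that matching never has to unify an index with
-- `a ℙ.+ b`.
data Broken : Pred (𝔽₂^ (3 + n)) 0ℓ where
  broken : ∀ {a b d} {v : 𝔽₂^ n} → d ≡ a ℙ.+ b → Paired v → Broken (a ∷ d ∷ b ∷ v)

broken-subspace : parity n ≡ 0ℙ → IsSubspace (Broken {n})
broken-subspace even = record
  { 0∈ = broken refl (paired-0 _ even)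
  ; ⊕∈ = λ { (broken {a = a} {b = b} refl p) (broken {a = a′} {b = b′} refl q) → broken (+-interchange a b a′ b′) (paired-⊕ p q) }
  }

-- The leading coordinates become a + 1, a + b and b + 1. They sum to 0, so an even number of them
-- is lit, hence at most 2.
∥broken⊕∥≤ : (v : 𝔽₂^ (3 + n)) → Broken v → ∥ v ⊕ (1ℙ ∷ 0ℙ ∷ 1ℙ ∷ alternating n) ∥ ≤ 2 + ⌊ n /2⌋
∥broken⊕∥≤ {n} _ (broken {a = a} {b = b} {v = v} refl p) = bound a b (v ⊕ alternating n) (∥paired⊕alternating∥ p)
  where
  bound : ∀ a b (u : 𝔽₂^ n) → ∥ u ∥ ≡ ⌊ n /2⌋ →
    ∥ (a ℙ.+ 1ℙ) ∷ ((a ℙ.+ b) ℙ.+ 0ℙ) ∷ (b ℙ.+ 1ℙ) ∷ u ∥ ≤ 2 + ⌊ n /2⌋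
  bound 0ℙ 0ℙ u eq = ℕ.≤-reflexive (cong (2 +_) eq)
  bound 0ℙ 1ℙ u eq = ℕ.≤-reflexive (cong (2 +_) eq)
  bound 1ℙ 0ℙ u eq = ℕ.≤-reflexive (cong (2 +_) eq)
  bound 1ℙ 1ℙ u eq = ℕ.≤-trans (ℕ.≤-reflexive eq) (ℕ.m≤n+m _ 2)

-- A leading 0 makes the next two coordinates equal. Thus the paired columns serve every vertex but
-- the first.
paired⇒broken : {v : 𝔽₂^ (2 + n)} → Paired v → Broken (0ℙ ∷ v)
paired⇒broken (a ∷ p) = broken refl p

-- Wirings for each parity of n and m.

even-even : parity n ≡ 0ℙ → parity m ≡ 0ℙ → 2 + m ≤ n → WiringBound n (2 + m) ⌈ n /2⌉
even-even {n} {m} n-even m-even m≤n = wiringInSubspace (paired-subspace n-even)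
  (pairedColumn n m n-even m-even m≤n) (alternating n)
  λ v p → ℕ.≤-trans (ℕ.≤-reflexive (∥paired⊕alternating∥ p)) (ℕ.⌊n/2⌋≤⌈n/2⌉ n)

-- The unpaired coordinate is always lit: it makes the weight odd, and the paired part carries the
-- even remainder.
odd-odd-column : parity n ≡ 0ℙ → parity m ≡ 0ℙ → 2 + m ≤ n → (j : Fin (suc n)) → Column (Paired ∘ tail) (3 + m) j
odd-odd-column {n} {m} n-even m-even m≤n zero with pairedOfWeight n (2 + m) n-even m-even m≤n
... | v , p , eq = 1ℙ ∷ v , p , refl , cong suc eq
odd-odd-column {n} {m} n-even m-even m≤n (suc j) with pairedColumn n m n-even m-even m≤n j
... | v , p , j∈ , eq = 1ℙ ∷ v , p , j∈ , cong suc eq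

odd-odd : parity n ≡ 0ℙ → parity m ≡ 0ℙ → 2 + m ≤ n → WiringBound (suc n) (3 + m) ⌈ suc n /2⌉
odd-odd {n} n-even m-even m≤n = wiringInSubspace (tail-subspace (paired-subspace n-even))
  (odd-odd-column n-even m-even m≤n) (0ℙ ∷ alternating n)
  λ { (a ∷ v) p → ∥∷∥≤ (a ℙ.+ 0ℙ) (v ⊕ alternating n) (ℕ.≤-reflexive (∥paired⊕alternating∥ p)) }

-- The two unpaired coordinates add at most 2 to the ⌊n/2⌋ from the pairs, one more than a further
-- pair would.
even-odd : parity n ≡ 0ℙ → parity m ≡ 0ℙ → 2 + m ≤ n → WiringBound (2 + n) (3 + m) (suc ⌊ 2 + n /2⌋)
even-odd {n} {m} n-even m-even m≤n = wiringInSubspace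
  (tail-subspace (tail-subspace (paired-subspace n-even))) columns (0ℙ ∷ 0ℙ ∷ alternating n)
  λ { (a ∷ b ∷ v) p → 
    ∥∷∥≤ (a ℙ.+ 0ℙ) ((b ℙ.+ 0ℙ) ∷ (v ⊕ alternating n))
      (∥∷∥≤ (b ℙ.+ 0ℙ) (v ⊕ alternating n) (ℕ.≤-reflexive (∥paired⊕alternating∥ p))) }
  where
  columns : ∀ j → Column (Paired ∘ tail ∘ tail) (3 + m) j
  columns zero with pairedOfWeight n (2 + m) n-even m-even m≤n
  -- Each column lights exactly one unpaired coordinate: vertex 0 its own, every other vertex the
  -- second one.
  ... | v , p , eq = 1ℙ ∷ 0ℙ ∷ v , p , refl , cong suc eq
  columns (suc j) with odd-odd-column n-even m-even m≤n j
  ... | v , p , j∈ , eq = 0ℙ ∷ v , p , j∈ , eq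

odd-even : parity n ≡ 0ℙ → parity m ≡ 0ℙ → m ≤ n → WiringBound (3 + n) (2 + m) ⌈ 3 + n /2⌉
odd-even {n} {m} n-even m-even m≤n = wiringInSubspace (broken-subspace n-even) columns
  (1ℙ ∷ 0ℙ ∷ 1ℙ ∷ alternating n) ∥broken⊕∥≤
  where
  columns : ∀ j → Column Broken (2 + m) j
  columns zero with pairedOfWeight n m n-even m-even m≤n
  -- With first coordinate 1, exactly one of the next two is 1, so the triple always has weight 2
  -- and the pairs supply `m`.
  ... | v , p , eq = 1ℙ ∷ 0ℙ ∷ 1ℙ ∷ v , broken refl p , refl , cong (2 +_) eq
  columns (suc j) with pairedColumn (2 + n) m n-even m-even (s≤s (s≤s m≤n)) j
  ... | v , p , j∈ , eq = 0ℙ ∷ v , paired⇒broken p , j∈ , eq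

-- Values of ν and ν*

odd⇒pred-even : ∀ n → parity (suc n) ≡ 1ℙ → parity n ≡ 0ℙ
odd⇒pred-even n odd = trans (sym (ℙ.suc-homo-⁻¹ n)) (cong ℙ._⁻¹ odd)

even≢odd : ∀ m n → parity m ≡ 0ℙ → parity n ≡ 1ℙ → ¬ parity m ≡ parity n
even≢odd m n m-even n-odd eq = contradiction (trans (sym m-even) (trans eq n-odd)) λ ()

≤∧parity≢⇒< : ∀ m n → ¬ parity m ≡ parity n → m ≤ n → m < n
≤∧parity≢⇒< m n parity≢ m≤n = ℕ.≤∧≢⇒< m≤n (parity≢ ∘ cong parity)

2∣⇒even : 2 ∣ n → parity n ≡ 0ℙ
2∣⇒even (divides q refl) = trans (ℙ.*-homo-* q 2) (ℙ.*-zeroʳ (parity q))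

even⇒2∣ : ∀ n → parity n ≡ 0ℙ → 2 ∣ n
even⇒2∣ zero          even = 2 ∣0
even⇒2∣ (suc (suc n)) even = ∣m∣n⇒∣m+n ∣-refl (even⇒2∣ n even)

¬even⇒odd : ∀ n → ¬ parity n ≡ 0ℙ → parity n ≡ 1ℙ
¬even⇒odd n ¬even with parity n
... | 0ℙ = contradiction refl ¬even
... | 1ℙ = refl

¬2∣⇒odd : ∀ n → ¬ 2 ∣ n → parity n ≡ 1ℙ
¬2∣⇒odd n ¬2∣n = ¬even⇒odd n (¬2∣n ∘ even⇒2∣ n)

odd⇒¬2∣ : ∀ n → parity n ≡ 1ℙ → ¬ 2 ∣ n
odd⇒¬2∣ n odd 2∣n = contradiction (trans (sym odd) (2∣⇒even 2∣n)) λ ()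

wiring≤⌈n/2⌉ : ∀ n m → 1 < m → m ≤ n → ¬ (2 ∣ n × ¬ 2 ∣ m) → WiringBound n m ⌈ n /2⌉
wiring≤⌈n/2⌉ n (suc (suc m)) _ m≤n ¬exceptional with parity n in n-eq | parity m in m-eq
... | 0ℙ | 0ℙ = even-even n-eq m-eq m≤n
... | 0ℙ | 1ℙ = contradiction (even⇒2∣ n n-eq , odd⇒¬2∣ (2 + m) m-eq) ¬exceptional
wiring≤⌈n/2⌉ (suc n) (suc (suc (suc m))) _ m≤n _ | 1ℙ | 1ℙ =
  odd-odd (odd⇒pred-even n n-eq) (odd⇒pred-even m m-eq) (s≤s⁻¹ m≤n)
wiring≤⌈n/2⌉ (suc (suc (suc n))) (suc (suc m)) _ m≤n _ | 1ℙ | 0ℙ =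
  odd-even (odd⇒pred-even n n-eq) m-eq
    -- The degree bound gives only `m ≤ suc n`; opposite parities sharpen it to the `m ≤ n` needed
    -- to place `m` on the pairs.
    (s≤s⁻¹ (≤∧parity≢⇒< m (suc n) (even≢odd m (suc n) m-eq n-eq) (s≤s⁻¹ (s≤s⁻¹ m≤n))))
wiring≤⌈n/2⌉ 1 (suc (suc m)) _ (s≤s ()) _ | 1ℙ | 0ℙ
wiring≤⌈n/2⌉ n 1 (s≤s ()) _ _

wiring≤1+⌊n/2⌋ : ∀ n m → 1 < m → m ≤ n → parity n ≡ 0ℙ → parity m ≡ 1ℙ → WiringBound n m (suc ⌊ n /2⌋)
wiring≤1+⌊n/2⌋ (suc (suc n)) (suc (suc (suc m))) _ m≤n n-even m-odd =
  even-odd n-even (odd⇒pred-even m m-odd) 2+m≤n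
  where
  2+m≤n : 2 + m ≤ n
  -- Two coordinates stay unpaired, leaving `suc m ≤ n`; since `n` is even and `suc m` odd, one more
  -- unit of room is gained.
  2+m≤n = ≤∧parity≢⇒< (suc m) n (even≢odd n (suc m) n-even m-odd ∘ sym) (s≤s⁻¹ (s≤s⁻¹ m≤n))

wiring≤1+⌊n/2⌋ _ 1 (s≤s ()) _ _ _
wiring≤1+⌊n/2⌋ 1 _ _ _ () _
wiring≤1+⌊n/2⌋ 0 (suc _) _ () _ _

deg≤ : (W : Mat n) → (∀ j → degree W j ≤ m) → deg W ≤ m
deg≤ {zero}  W _       = z≤n
deg≤ {suc n} W degrees with deg-attained W
... | j , eq = subst (_≤ _) (sym eq) (degrees j)

-- The exact degree `l` of the witness may be smaller than `m`. A wiring of degree 2 then serves all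
-- m > 1, including m > n, where no column has weight m.
ν≡⌈n/2⌉ : ∀ n m {l} → WiringBound n l ⌈ n /2⌉ → l ≤ m → ν n m ≡ ⌈ n /2⌉
ν≡⌈n/2⌉ n m (W , c , (wiring , degrees) , M≤) l≤m = ℕ.≤-antisym
  (ℕ.≤-trans (minM≤M (A? n m) {W} W∈A c) M≤)
  (lower (minM-attained (A? n m) (W , W∈A)))
  where
  W∈A : A n m W
  W∈A = wiring , deg≤ W λ j → ℕ.≤-trans (ℕ.≤-reflexive (degrees j)) l≤m

  lower : ∃[ W′ ] ∃[ c′ ] A n m W′ × ν n m ≡ M W′ c′ → ⌈ n /2⌉ ≤ ν n m
  lower (W′ , c′ , (wiring′ , _) , eq) = subst (⌈ n /2⌉ ≤_) (sym eq) (⌈n/2⌉≤M W′ c′ wiring′)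

-- A single vertex admits no column of weight 2; here the trivial bound M ≤ n is already sharp.
wiring₁ : WiringBound 1 1 1
wiring₁ = W , c , ((λ { zero → refl }) , λ { zero → refl }) , M≤n W c
  where
  W : Mat 1
  W = (1ℙ ∷ []) ∷ []
  c : 𝔽₂^ 1
  c = 0ℙ ∷ []

¬exceptional-2 : ¬ (2 ∣ n × ¬ 2 ∣ 2)
¬exceptional-2 (_ , ¬2∣2) = ¬2∣2 ∣-refl

ν-value : ∀ n m → 1 ≤ n → 1 < m → ν n m ≡ ⌈ n /2⌉
ν-value 1             m _ 1<m = ν≡⌈n/2⌉ 1 m wiring₁ (ℕ.<⇒≤ 1<m)
ν-value (suc (suc n)) m _ 1<m =
  ν≡⌈n/2⌉ (2 + n) m (wiring≤⌈n/2⌉ (2 + n) 2 ℕ.≤-refl (s≤s (s≤s z≤n)) ¬exceptional-2) 1<m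

ν₁-value : ∀ n → 1 ≤ n → ν₁ n ≡ ⌈ n /2⌉
-- ν(1) is ν(1,1), outside the range m > 1 of `ν-value`.
ν₁-value 1             _   = ν≡⌈n/2⌉ 1 1 wiring₁ ℕ.≤-refl
ν₁-value (suc (suc n)) 1≤n = ν-value (2 + n) (2 + n) 1≤n (s≤s (s≤s z≤n))

ν*≡ : ∀ n m {b} → WiringBound n m b → (∀ W c → A* n m W → b ≤ M W c) → ν* n m ≡ b
ν*≡ n m {b} (W , c , W∈A* , M≤) b≤M = ℕ.≤-antisym
  (ℕ.≤-trans (minM≤M (A*? n m) {W} W∈A* c) M≤)
  (lower (minM-attained (A*? n m) (W , W∈A*)))
  where
  lower : ∃[ W′ ] ∃[ c′ ] A* n m W′ × ν* n m ≡ M W′ c′ → b ≤ ν* n m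
  lower (W′ , c′ , W′∈A* , eq) = subst (b ≤_) (sym eq) (b≤M W′ c′ W′∈A*)

ν*-regular : ∀ n m → 1 < m → m ≤ n → ¬ (2 ∣ n × ¬ 2 ∣ m) → ν* n m ≡ ⌈ n /2⌉
ν*-regular n m 1<m m≤n ¬exceptional =
  ν*≡ n m (wiring≤⌈n/2⌉ n m 1<m m≤n ¬exceptional) λ W c (wiring , _) → ⌈n/2⌉≤M W c wiring

even⇒⌊n/2⌋≡⌈n/2⌉ : ∀ n → parity n ≡ 0ℙ → ⌊ n /2⌋ ≡ ⌈ n /2⌉
even⇒⌊n/2⌋≡⌈n/2⌉ zero          _    = refl
even⇒⌊n/2⌋≡⌈n/2⌉ (suc (suc n)) even = cong suc (even⇒⌊n/2⌋≡⌈n/2⌉ n even)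

ν*-exceptional : ∀ n m → 1 < m → m ≤ n → parity n ≡ 0ℙ → parity m ≡ 1ℙ → ν* n m ≡ suc ⌈ n /2⌉
ν*-exceptional n m 1<m m≤n n-even m-odd = trans
  (ν*≡ n m (wiring≤1+⌊n/2⌋ n m 1<m m≤n n-even m-odd) λ W c (wiring , degrees) →
    ⌊n/2⌋<M W c 1≤n wiring λ j → trans (cong parity (degrees j)) m-odd)
  (cong suc (even⇒⌊n/2⌋≡⌈n/2⌉ n n-even))
  where
  1≤n : 1 ≤ n
  1≤n = ℕ.≤-trans (ℕ.<⇒≤ 1<m) m≤n

theorem3p2 : (∀ (n m : ℕ) → 1 ≤ n → 1 < m →
    (ν₁ n ≡ ν n m × ν n m ≡ ⌈ n /2⌉)
    × (m ≤ n →
    (2 ∣ n × ¬ 2 ∣ m → ν* n m ≡ ν n m + 1)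
    × (¬ (2 ∣ n × ¬ 2 ∣ m) → ν* n m ≡ ν n m)))
    × (∀ (n : ℕ) → 1 < n → ν* n 2 ≡ ν₁* n × ν₁* n ≡ ν₁ n)
theorem3p2 = general , special
  where
  general : ∀ (n m : ℕ) → 1 ≤ n → 1 < m →
    (ν₁ n ≡ ν n m × ν n m ≡ ⌈ n /2⌉)
    × (m ≤ n →
    (2 ∣ n × ¬ 2 ∣ m → ν* n m ≡ ν n m + 1)
    × (¬ (2 ∣ n × ¬ 2 ∣ m) → ν* n m ≡ ν n m))
  general n m 1≤n 1<m = (trans (ν₁-value n 1≤n) (sym ν-eq) , ν-eq) , λ m≤n →
    (λ (2∣n , ¬2∣m) → trans (ν*-exceptional n m 1<m m≤n (2∣⇒even 2∣n) (¬2∣⇒odd m ¬2∣m))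
      (trans (ℕ.+-comm 1 ⌈ n /2⌉) (cong (_+ 1) (sym ν-eq)))) ,
    λ ¬exceptional → trans (ν*-regular n m 1<m m≤n ¬exceptional) (sym ν-eq)
    where
    ν-eq : ν n m ≡ ⌈ n /2⌉
    ν-eq = ν-value n m 1≤n 1<m

  special : ∀ (n : ℕ) → 1 < n → ν* n 2 ≡ ν₁* n × ν₁* n ≡ ν₁ n
  special n 1<n =
    trans (ν*-regular n 2 ℕ.≤-refl 1<n ¬exceptional-2) (sym ν₁*-eq) ,
    trans ν₁*-eq (sym (ν₁-value n (ℕ.<⇒≤ 1<n)))
    where
    ν₁*-eq : ν₁* n ≡ ⌈ n /2⌉
    -- The case m = n is never exceptional, as n would have to be both even and odd.
    ν₁*-eq = ν*-regular n n 1<n ℕ.≤-refl λ (2∣n , ¬2∣n) → ¬2∣n 2∣n
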